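{- Let $q$ be an odd prime power such that $q\equiv1\pmod 4$ and let $\gamma\in\mathbb{F}_{q^2}$. The polynomial $f(x)=x+\gamma\,\mathrm{Tr}\left(x^{q+3}\right)$ over $\mathbb{F}_{q^2}$ is a permutation polynomial if and only if $\gamma=0$.
   Context: $\mathrm{Tr}:\mathbb{F}_{q^2}\to\mathbb{F}_q$ is the trace map $\mathrm{Tr}(x)=x+x^q$. A polynomial $f$ over $\mathbb{F}_{q^2}$ is a permutation polynomial if the map $x\mapsto f(x)$ is a bijection of $\mathbb{F}_{q^2}$ onto itself. -}

module Defs where

open import Level using (Level; _⊔_)
open import Data.Nat.Base as ℕ using (ℕ; _≥_)
open import Data.Nat.Primality using (Prime)
open import Data.Fin.Base using (Fin)
open import Data.Product.Base using (∃; ∃₂; _×_)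
open import Relation.Nullary.Negation.Core using (¬_)
open import Relation.Binary.PropositionalEquality as ≡ using (_≡_)
open import Relation.Binary.Bundles using (Setoid)
open import Algebra.Bundles using (CommutativeRing)
open import Function.Bundles using (Bijection)
open import Function.Definitions using (Bijective)
import Algebra.Properties.Semiring.Exp as Exp

private
  variable
    c ℓ : Level

PrimePower : ℕ → Set
PrimePower q = ∃₂ λ p k → Prime p × k ≥ 1 × q ≡ p ℕ.^ k

-- The library's only field bundle, HeytingField, carries an apartness relation
-- as extra structure. On a finite carrier equality is decidable, so ¬ x ≈ 0#
-- serves as "nonzero" without loss.
record IsField (R : CommutativeRing c ℓ) : Set (c ⊔ ℓ) where
  open CommutativeRing R
  field
    1≉0     : ¬ 1# ≈ 0#
    inverse : ∀ x → ¬ x ≈ 0# → ∃ λ y → x * y ≈ 1#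

HasCardinality : Setoid c ℓ → ℕ → Set (c ⊔ ℓ)
HasCardinality S n = Bijection (≡.setoid (Fin n)) S

record IsFiniteField (R : CommutativeRing c ℓ) (n : ℕ) : Set (c ⊔ ℓ) where
  field
    isField     : IsField R
    cardinality : HasCardinality (CommutativeRing.setoid R) n

module _ (R : CommutativeRing c ℓ) where
  open CommutativeRing R
  open Exp semiring using (_^_)

  -- 𝔽_q is identified with the subfield { x | x ^ q ≈ x } of 𝔽_{q²}, so the
  -- trace 𝔽_{q²} → 𝔽_q takes its values in the ambient field.
  Tr : ℕ → Carrier → Carrier
  Tr q x = x + x ^ q

  -- A polynomial enters only through the map x ↦ f(x) it induces.
  IsPermutation : (Carrier → Carrier) → Set (c ⊔ ℓ)
  IsPermutation f = Bijective _≈_ _≈_ f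

  poly : ℕ → Carrier → Carrier → Carrier
  poly q γ x = x + γ * Tr q (x ^ (q ℕ.+ 3))

{-# OPTIONS --safe #-}
module Submission where

-- T (x) = Tr (x ^ (q+3)) is 𝔽_q-valued, and T (γ x) = T (γ) x⁴ for x ∈ 𝔽_q. Hence, for γ ≠ 0,
-- π (x) = γ⁻¹ f (γ x) = x + T (γ x) maps 𝔽_q and its complement to themselves, and on 𝔽_q it is x + c x⁴
-- with c = T (γ). If f permutes the field, π permutes 𝔽_q, which Hermite's criterion with exponent (q-1)/4
-- forbids unless c = 0. But c = 0 would make γ ^ ((q+3)(q-1)) equal to -1, impossible for q ≡ 1 mod 4.
-- Sums over 𝔽_q are sums over 𝔽_{q²} weighted by the indicator χ of { x | x ^ q = x }, so 𝔽_q is never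
-- enumerated: its power sums follow from the invariance of χ under translation by 1 and scaling by norms.

open import Defs
open import Level using (Level)
open import Data.Nat.Base using (ℕ; zero; suc; _^_; _%_; _<_; _≤_; z≤n; s≤s; s<s; z<s)
import Data.Nat.Base as ℕ
import Data.Nat.Properties as ℕ
import Data.Nat.DivMod as ℕ
open import Data.Nat.Tactic.RingSolver using (solve-∀)
open import Data.Bool.Base using (if_then_else_)
open import Data.Nat.Combinatorics using (_C_; nC1≡n; nCn≡1; nCk+nC[k+1]≡[n+1]C[k+1])
open import Data.Nat.Divisibility as ∣ using (_∣_; divides; m∣m*n; >⇒∤)
open import Data.Nat.Divisibility.Core using (_∤_)
open import Data.Nat.Primality using (Prime; euclidsLemma)
open import Data.Fin.Base as Fin using (Fin; toℕ; fromℕ; inject₁; inject≤; punchIn)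
open import Data.Fin.Properties as Fin using (toℕ-fromℕ; toℕ-inject₁; toℕ<n; inject≤-injective; suc-injective; punchInᵢ≢i)
open import Data.Fin.Permutation using (Permutation; permutation)
open import Data.Vec.Functional using (Vector; replicate)
open import Data.Product.Base using (∃; _,_; proj₁; proj₂) renaming (_×_ to _∧_)
open import Data.Sum.Base using (inj₁; inj₂)
open import Function.Base using (_∘_; id)
open import Relation.Nullary using (¬_; Dec; yes; no; contradiction)
import Relation.Nullary.Decidable as Dec
open import Relation.Binary.PropositionalEquality.Core using (_≡_; _≢_)
import Relation.Binary.PropositionalEquality as ≡
open import Algebra.Bundles using (CommutativeRing; CommutativeMonoid; CommutativeSemiring)
open import Function.Bundles using (_⇔_; mk⇔; Bijection)
import Algebra.Properties.CommutativeSemigroup as CommutativeSemigroupProperties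
import Algebra.Properties.CommutativeMonoid.Sum as CMSum
import Algebra.Properties.CommutativeSemiring.Exp as CSExp
import Algebra.Properties.CommutativeSemiring.Binomial as CSBinomial
import Algebra.Properties.Monoid.Mult as MMult
import Algebra.Properties.Semiring.Mult as SMult
import Algebra.Properties.Semiring.Sum as SSum
import Algebra.Properties.Ring as RingProperties
import Function.Construct.Composition as Composition
import Function.Consequences.Setoid as Consequences
import Relation.Binary.Reasoning.Setoid as SetoidReasoning

-- Binomial coefficients modulo a prime.

[k+1]*[n+1]C[k+1] : ∀ n k → suc k ℕ.* (suc n C suc k) ≡ suc n ℕ.* (n C k)
[k+1]*[n+1]C[k+1] n zero = ≡.trans (ℕ.*-identityˡ _) (≡.trans (nC1≡n (suc n)) (≡.sym (ℕ.*-identityʳ _)))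
[k+1]*[n+1]C[k+1] zero (suc k) = ℕ.*-zeroʳ (suc (suc k))
[k+1]*[n+1]C[k+1] (suc n) (suc k) = begin
  suc (suc k) ℕ.* (suc (suc n) C suc (suc k))
    ≡⟨ ≡.cong (suc (suc k) ℕ.*_) (nCk+nC[k+1]≡[n+1]C[k+1] (suc n) (suc k)) ⟨
  suc (suc k) ℕ.* (c₁ ℕ.+ c₂)
    ≡⟨ rearr (suc k) c₁ c₂ ⟩
  c₁ ℕ.+ (suc k ℕ.* c₁ ℕ.+ suc (suc k) ℕ.* c₂)
    ≡⟨ ≡.cong (c₁ ℕ.+_) (≡.cong₂ ℕ._+_ ([k+1]*[n+1]C[k+1] n k) ([k+1]*[n+1]C[k+1] n (suc k))) ⟩
  c₁ ℕ.+ (suc n ℕ.* (n C k) ℕ.+ suc n ℕ.* (n C suc k))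
    ≡⟨ ≡.cong (c₁ ℕ.+_) (ℕ.*-distribˡ-+ (suc n) (n C k) (n C suc k)) ⟨
  c₁ ℕ.+ suc n ℕ.* (n C k ℕ.+ n C suc k)
    ≡⟨ ≡.cong (λ z → c₁ ℕ.+ suc n ℕ.* z) (nCk+nC[k+1]≡[n+1]C[k+1] n k) ⟩
  suc (suc n) ℕ.* c₁ ∎
  where
  open ≡.≡-Reasoning
  c₁ = suc n C suc k
  c₂ = suc n C suc (suc k)
  rearr : ∀ k a b → suc k ℕ.* (a ℕ.+ b) ≡ a ℕ.+ (k ℕ.* a ℕ.+ suc k ℕ.* b)
  rearr = solve-∀

-- By the absorption identity above, p divides (k + 1) C(p, k + 1), but not k + 1, which is positive
-- and below p.
prime∣C : ∀ {p} → Prime p → ∀ k → suc k < p → p ∣ p C suc k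
prime∣C {suc p} pr k k<p
  with euclidsLemma (suc k) (suc p C suc k) pr
         (∣.∣-trans (m∣m*n (p C k)) (∣.∣-reflexive (≡.sym ([k+1]*[n+1]C[k+1] p k))))
... | inj₁ p∣k = contradiction p∣k (>⇒∤ k<p)
... | inj₂ p∣C = p∣C

-- Taking c x⁴ out of one factor of (x + c x⁴) ↑ (k + 1) raises the power of x in front by four, so
-- degree bounds pass unchanged through the expansion of the quartic.
4[1+k]+a : ∀ k a → 4 ℕ.* suc k ℕ.+ a ≡ 4 ℕ.* k ℕ.+ (4 ℕ.+ a)
4[1+k]+a = solve-∀

-- Additivity of the Frobenius map in characteristic p.

module CharacteristicP {c ℓ} (S : CommutativeSemiring c ℓ) where
  open CommutativeSemiring S
  open CSExp S renaming (_^_ to _↑_)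
  open SMult semiring
  open SSum semiring using (sum; sum-init-last; sum-cong-≋; sum-replicate-zero)
  open CSBinomial S using () renaming (theorem to binomial-theorem)
  open SetoidReasoning setoid

  sum-head-last : ∀ m (t : Vector Carrier (suc (suc m))) →
    (∀ i → t (Fin.suc (inject₁ i)) ≈ 0#) → sum t ≈ t Fin.zero + t (fromℕ (suc m))
  sum-head-last m t mid = +-congˡ (begin
    sum (t ∘ Fin.suc)                                 ≈⟨ sum-init-last (t ∘ Fin.suc) ⟩
    sum (λ i → t (Fin.suc (inject₁ i))) + t (fromℕ (suc m)) ≈⟨ +-congʳ (trans (sum-cong-≋ mid) (sum-replicate-zero m)) ⟩
    0# + t (fromℕ (suc m))                            ≈⟨ +-identityˡ _ ⟩
    t (fromℕ (suc m))                                 ∎)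

  ∣⇒×≈0 : ∀ {p n} → p × 1# ≈ 0# → p ∣ n → ∀ x → n × x ≈ 0#
  ∣⇒×≈0 {p} {n} p≈0 (divides k ≡.refl) x = begin
    (k ℕ.* p) × x            ≈⟨ ×-congʳ (k ℕ.* p) (*-identityˡ x) ⟨
    (k ℕ.* p) × (1# * x)     ≈⟨ ×-assoc-* (k ℕ.* p) 1# x ⟨
    ((k ℕ.* p) × 1#) * x     ≈⟨ *-congʳ (×1-homo-* k p) ⟩
    (k × 1#) * (p × 1#) * x  ≈⟨ *-congʳ (trans (*-congˡ p≈0) (zeroʳ _)) ⟩
    0# * x                   ≈⟨ zeroˡ x ⟩
    0#                       ∎

  -- Only the two end terms of the binomial expansion survive, since the inner coefficients are
  -- multiples of p.
  ^p-homo-+ : ∀ {p} → Prime p → p × 1# ≈ 0# → ∀ x y → (x + y) ↑ p ≈ x ↑ p + y ↑ p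
  ^p-homo-+ {suc p} pr p≈0 x y = begin
    (x + y) ↑ suc p                 ≈⟨ binomial-theorem (suc p) x y ⟩
    sum term                        ≈⟨ sum-head-last p term mid ⟩
    -- The term of index k carries x to the power k, so index zero contributes the power of y and
    -- the last index that of x.
    term Fin.zero + term (fromℕ (suc p)) ≈⟨ +-comm _ _ ⟩
    term (fromℕ (suc p)) + term Fin.zero ≈⟨ +-cong lst (trans (×-homo-1 _) (*-identityˡ _)) ⟩
    x ↑ suc p + y ↑ suc p           ∎
    where
    term : Vector Carrier (suc (suc p))
    term = CSBinomial.binomialTerm S x y (suc p)
    mid : ∀ i → term (Fin.suc (inject₁ i)) ≈ 0#
    mid i = ∣⇒×≈0 p≈0 (prime∣C pr (toℕ (inject₁ i))
      (s<s (≡.subst (_< p) (≡.sym (toℕ-inject₁ i)) (toℕ<n i)))) _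
    lst : term (fromℕ (suc p)) ≈ x ↑ suc p
    lst rewrite toℕ-fromℕ p | nCn≡1 (suc p) | ℕ.n∸n≡0 p = trans (×-homo-1 _) (*-identityʳ _)

  ^pᵏ-homo-+ : ∀ {p} → Prime p → p × 1# ≈ 0# →
    ∀ k x y → (x + y) ↑ (p ^ k) ≈ x ↑ (p ^ k) + y ↑ (p ^ k)
  ^pᵏ-homo-+ pr p≈0 zero x y = trans (*-identityʳ _) (sym (+-cong (*-identityʳ _) (*-identityʳ _)))
  ^pᵏ-homo-+ {p} pr p≈0 (suc k) x y = begin
    (x + y) ↑ (p ℕ.* p ^ k)                 ≈⟨ ^-assocʳ (x + y) p (p ^ k) ⟨
    ((x + y) ↑ p) ↑ (p ^ k)                 ≈⟨ ^-congˡ (p ^ k) (^p-homo-+ pr p≈0 x y) ⟩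
    (x ↑ p + y ↑ p) ↑ (p ^ k)               ≈⟨ ^pᵏ-homo-+ pr p≈0 k _ _ ⟩
    (x ↑ p) ↑ (p ^ k) + (y ↑ p) ↑ (p ^ k)   ≈⟨ +-cong (^-assocʳ x p _) (^-assocʳ y p _) ⟩
    x ↑ (p ℕ.* p ^ k) + y ↑ (p ℕ.* p ^ k)   ∎

-- Sums with a single nontrivial term.

module _ {c ℓ} (M : CommutativeMonoid c ℓ) where
  open CommutativeMonoid M
  open CMSum M using (sum; sum-remove; sum-cong-≋; sum-replicate-zero)
  open SetoidReasoning setoid

  sum-singleton : ∀ {n} (i : Fin n) (t : Vector Carrier n) → (∀ j → j ≢ i → t j ≈ ε) → sum t ≈ t i
  sum-singleton {suc n} i t t≈ε = begin
    sum t                         ≈⟨ sum-remove t ⟩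
    t i ∙ sum (t ∘ punchIn i)     ≈⟨ ∙-congˡ (sum-cong-≋ (λ j → t≈ε (punchIn i j) (punchInᵢ≢i i j))) ⟩
    t i ∙ sum (replicate n ε)     ≈⟨ ∙-congˡ (sum-replicate-zero n) ⟩
    t i ∙ ε                       ≈⟨ identityʳ _ ⟩
    t i                           ∎

-- Monic polynomial functions and the number of their roots.

module MonicPolynomials {c ℓ} (R : CommutativeRing c ℓ) where
  open CommutativeRing R
  open RingProperties ring
  open import Algebra.Solver.Ring.NaturalCoefficients.Default commutativeSemiring
  open CSExp commutativeSemiring renaming (_^_ to _↑_) using ()
  open SetoidReasoning setoid

  -- Functions presented by Horner's scheme up to pointwise equality, with `k` the constant
  -- coefficient; this avoids coefficient lists and evaluation.
  data Monic : ℕ → (Carrier → Carrier) → Set (c Level.⊔ ℓ) where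
    one    : ∀ {f} → (∀ x → f x ≈ 1#) → Monic 0 f
    horner : ∀ {d f g} k → Monic d g → (∀ x → f x ≈ x * g x + k) → Monic (suc d) f

  monic-↑ : ∀ d → Monic d (_↑ d)
  monic-↑ zero    = one (λ _ → refl)
  monic-↑ (suc d) = horner 0# (monic-↑ d) (λ _ → sym (+-identityʳ _))

  -- Synthetic division: if h is the quotient of g by x - a, then that of x g + k is x h + g(a),
  -- again monic.
  factor : ∀ {d f} → Monic (suc d) f → ∀ a →
    ∃ λ g → Monic d g ∧ (∀ x → f x ≈ f a + (x - a) * g x)
  factor {zero} {f} (horner {g = g} k (one g≈1) f≈) a = (λ _ → 1#) , one (λ _ → refl) , λ x → begin
    f x                     ≈⟨ f≈ x ⟩
    x * g x + k             ≈⟨ +-congʳ (trans (*-congˡ (g≈1 x)) (*-identityʳ x)) ⟩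
    -- With x written as (x - a) + a, what remains is a semiring identity in which x - a is an atom.
    x + k                   ≈⟨ +-congʳ (//-rightDividesˡ a x) ⟨
    (x - a) + a + k         ≈⟨ solve 3 (λ d a k → (d :+ a) :+ k := (a :+ k) :+ d) refl (x - a) a k ⟩
    (a + k) + (x - a)       ≈⟨ +-cong (+-congʳ (trans (*-congˡ (g≈1 a)) (*-identityʳ a))) (*-identityʳ _) ⟨
    (a * g a + k) + (x - a) * 1# ≈⟨ +-congʳ (f≈ a) ⟨
    f a + (x - a) * 1#      ∎
  factor {suc d} {f} (horner {g = g} k monic-g f≈) a with factor monic-g a
  ... | h , monic-h , g≈ = (λ x → x * h x + g a) , horner (g a) monic-h (λ _ → refl) , λ x → begin
    f x                                            ≈⟨ f≈ x ⟩
    x * g x + k                                    ≈⟨ +-congʳ (*-congˡ (g≈ x)) ⟩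
    x * (g a + (x - a) * h x) + k                  ≈⟨ +-congʳ (distribˡ x _ _) ⟩
    x * g a + x * ((x - a) * h x) + k              ≈⟨ +-congʳ (+-congʳ (*-congʳ (//-rightDividesˡ a x))) ⟨
    ((x - a) + a) * g a + x * ((x - a) * h x) + k
      ≈⟨ solve 6 (λ e a b x y k → ((e :+ a) :* b :+ x :* (e :* y)) :+ k := (a :* b :+ k) :+ e :* (x :* y :+ b))
           refl (x - a) a (g a) x (h x) k ⟩
    (a * g a + k) + (x - a) * (x * h x + g a)      ≈⟨ +-congʳ (f≈ a) ⟨
    f a + (x - a) * (x * h x + g a)                ∎

  module _ (1≉0 : ¬ 1# ≈ 0#) (cancel : ∀ {x y} → ¬ x ≈ 0# → x * y ≈ 0# → y ≈ 0#) where

    -- Induction on the degree: after division by x - r₀, the remaining points are roots of the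
    -- quotient, because their differences from r₀ are nonzero and can be cancelled.
    monic-roots : ∀ {d f} → Monic d f → (r : Fin (suc d) → Carrier) →
      (∀ {i j} → r i ≈ r j → i ≡ j) → ¬ (∀ i → f (r i) ≈ 0#)
    monic-roots (one f≈1) r r-inj f≈0 = 1≉0 (trans (sym (f≈1 _)) (f≈0 Fin.zero))
    monic-roots {suc d} {f} m r r-inj f≈0 with factor m (r Fin.zero)
    ... | g , monic-g , f≈ = monic-roots monic-g (r ∘ Fin.suc) (suc-injective ∘ r-inj) λ i →
      cancel (λ eq → contradiction (r-inj (x∙y⁻¹≈ε⇒x≈y _ _ eq)) λ ()) (begin
        (r (Fin.suc i) - r Fin.zero) * g (r (Fin.suc i))                ≈⟨ +-identityˡ _ ⟨
        0# + (r (Fin.suc i) - r Fin.zero) * g (r (Fin.suc i))           ≈⟨ +-congʳ (f≈0 Fin.zero) ⟨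
        f (r Fin.zero) + (r (Fin.suc i) - r Fin.zero) * g (r (Fin.suc i)) ≈⟨ f≈ _ ⟨
        f (r (Fin.suc i))                                                ≈⟨ f≈0 (Fin.suc i) ⟩
        0#                                                               ∎)

-- Finite fields: sums and products over all elements.

module FiniteField {c ℓ} (F : CommutativeRing c ℓ) {n} (fin : IsFiniteField F n) where
  open CommutativeRing F
  open IsFiniteField fin
  open IsField isField
  open Bijection cardinality using (surjective) renaming (to to elem; injective to elem-injective)
  open RingProperties ring
  open CSExp commutativeSemiring renaming (_^_ to _↑_)
  open SMult semiring using (_×_)
  open MonicPolynomials F
  open Consequences setoid setoid using (inverseᵇ⇒bijective)
  open SetoidReasoning setoid

  index : Carrier → Fin n
  index x = proj₁ (surjective x)

  elem-index : ∀ x → elem (index x) ≈ x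
  elem-index x = proj₂ (surjective x) ≡.refl

  infix 4 _≟_
  -- Opaque, so that with-abstraction over x ≟ y finds it unreduced in goals.
  abstract
    _≟_ : ∀ x y → Dec (x ≈ y)
    x ≟ y = Dec.map′
      (λ eq → trans (sym (elem-index x)) (trans (reflexive (≡.cong elem eq)) (elem-index y)))
      (λ x≈y → elem-injective (trans (elem-index x) (trans x≈y (sym (elem-index y)))))
      (index x Fin.≟ index y)

  *-cancelˡ-≉0 : ∀ {a x y} → ¬ a ≈ 0# → a * x ≈ a * y → x ≈ y
  *-cancelˡ-≉0 {a} {x} {y} a≉0 eq with inverse a a≉0
  ... | b , ab≈1 = begin
    x            ≈⟨ *-identityʳ x ⟨
    x * 1#       ≈⟨ *-congˡ ab≈1 ⟨
    x * (a * b)  ≈⟨ trans (sym (*-assoc x a b)) (*-congʳ (*-comm x a)) ⟩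
    a * x * b    ≈⟨ *-congʳ eq ⟩
    a * y * b    ≈⟨ trans (*-congʳ (*-comm a y)) (*-assoc y a b) ⟩
    y * (a * b)  ≈⟨ *-congˡ ab≈1 ⟩
    y * 1#       ≈⟨ *-identityʳ y ⟩
    y            ∎

  x*y≈0⇒y≈0 : ∀ {x y} → ¬ x ≈ 0# → x * y ≈ 0# → y ≈ 0#
  x*y≈0⇒y≈0 x≉0 xy≈0 = *-cancelˡ-≉0 x≉0 (trans xy≈0 (sym (zeroʳ _)))

  ↑-≉0 : ∀ {x} k → ¬ x ≈ 0# → ¬ x ↑ k ≈ 0#
  ↑-≉0 zero    x≉0 = 1≉0
  ↑-≉0 (suc k) x≉0 = ↑-≉0 k x≉0 ∘ x*y≈0⇒y≈0 x≉0

  x↑k≈0⇒x≈0 : ∀ {x} k → x ↑ k ≈ 0# → x ≈ 0#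
  x↑k≈0⇒x≈0 {x} k eq = Dec.decidable-stable (x ≟ 0#) (λ x≉0 → ↑-≉0 k x≉0 eq)

  0↑ : ∀ {k} → 0 < k → 0# ↑ k ≈ 0#
  0↑ {suc k} _ = zeroˡ _

  1↑ : ∀ k → 1# ↑ k ≈ 1#
  1↑ zero    = refl
  1↑ (suc k) = trans (*-identityˡ _) (1↑ k)

  -- Generic in the monoid so that sums and products over the field share one development; the
  -- enumeration stays hidden behind the opaque block.
  module Over {c′ ℓ′} (M : CommutativeMonoid c′ ℓ′) where
    private module M = CommutativeMonoid M
    open CMSum M using (sum; sum-permute; sum-cong-≋; ∑-distrib-+; sum-replicate)
    open MMult M.monoid using () renaming (_×_ to _×ᴹ_)

    opaque
      ⨁ : (Carrier → M.Carrier) → M.Carrier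
      ⨁ g = sum (g ∘ elem)

      ⨁-cong : ∀ {g h} → (∀ x → g x M.≈ h x) → ⨁ g M.≈ ⨁ h
      ⨁-cong g≈h = sum-cong-≋ (g≈h ∘ elem)

      ⨁-∙ : ∀ g h → ⨁ (λ x → g x M.∙ h x) M.≈ ⨁ g M.∙ ⨁ h
      ⨁-∙ g h = ∑-distrib-+ (g ∘ elem) (h ∘ elem)

      ⨁-const : ∀ a → ⨁ (λ _ → a) M.≈ n ×ᴹ a
      ⨁-const a = sum-replicate n

      -- Conjugation by the enumeration turns π into a permutation of indices; its inverse `ρ` is
      -- read off from surjectivity and is two-sided by injectivity.
      ⨁-reindex : ∀ {g π} → (∀ {x y} → x ≈ y → g x M.≈ g y) →
        (∀ {x y} → x ≈ y → π x ≈ π y) → IsPermutation F π → ⨁ g M.≈ ⨁ (g ∘ π)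
      ⨁-reindex {g} {π} g-cong π-cong (π-inj , π-surj) =
        M.trans (sum-permute (g ∘ elem) σ) (sum-cong-≋ (λ i → g-cong (elem-index (π (elem i)))))
        where
        ρ : Carrier → Carrier
        ρ y = proj₁ (π-surj y)
        πρ : ∀ y {z} → z ≈ ρ y → π z ≈ y
        πρ y = proj₂ (π-surj y)
        σ : Permutation n n
        σ = permutation (index ∘ π ∘ elem) (index ∘ ρ ∘ elem)
          (λ j → elem-injective (trans (elem-index _) (πρ (elem j) (elem-index _))))
          (λ i → elem-injective (trans (elem-index _)
            (π-inj (trans (πρ _ refl) (elem-index _)))))

      ⨁-singleton : ∀ {g v} a → (∀ {x} → x ≈ a → g x M.≈ v) → (∀ {x} → ¬ x ≈ a → g x M.≈ M.ε) → ⨁ g M.≈ v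
      ⨁-singleton a g≈v g≈ε = M.trans
        (sum-singleton M (index a) _ (λ j j≢ →
          g≈ε (λ eq → j≢ (elem-injective (trans eq (sym (elem-index a)))))))
        (g≈v (elem-index a))

  open Over +-commutativeMonoid public renaming (⨁ to ∑; ⨁-cong to ∑-cong; ⨁-reindex to ∑-reindex; ⨁-singleton to ∑-singleton; ⨁-∙ to ∑-+; ⨁-const to ∑-const)
  open Over *-commutativeMonoid public renaming (⨁ to ∏; ⨁-cong to ∏-cong; ⨁-reindex to ∏-reindex; ⨁-singleton to ∏-singleton; ⨁-∙ to ∏-*; ⨁-const to ∏-const)

  opaque
    unfolding Over.⨁

    ∑-*ˡ : ∀ a g → ∑ (λ x → a * g x) ≈ a * ∑ g
    ∑-*ˡ a g = sym (SSum.*-distribˡ-sum semiring a (g ∘ elem))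

    ∏-≉0 : ∀ {g} → (∀ x → ¬ g x ≈ 0#) → ¬ ∏ g ≈ 0#
    ∏-≉0 {g} g≉0 = lemma (g ∘ elem) (g≉0 ∘ elem)
      where
      lemma : ∀ {k} (t : Vector Carrier k) → (∀ i → ¬ t i ≈ 0#) → ¬ CMSum.sum *-commutativeMonoid t ≈ 0#
      lemma {zero}  t t≉0 = 1≉0
      lemma {suc k} t t≉0 = lemma (t ∘ Fin.suc) (t≉0 ∘ Fin.suc) ∘ x*y≈0⇒y≈0 (t≉0 Fin.zero)

  translate-permutes : ∀ t → IsPermutation F (_+ t)
  translate-permutes t = inverseᵇ⇒bijective
    ( (λ {x} y≈ → trans (+-congʳ y≈) (//-rightDividesˡ t x))
    , (λ {x} y≈ → trans (+-congʳ y≈) (//-rightDividesʳ t x)))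

  scale-permutes : ∀ {a} → ¬ a ≈ 0# → IsPermutation F (a *_)
  scale-permutes {a} a≉0 with inverse a a≉0
  ... | b , ab≈1 = *-cancelˡ-≉0 a≉0 , λ y → b * y , λ {z} z≈ → begin
    a * z        ≈⟨ *-congˡ z≈ ⟩
    a * (b * y)  ≈⟨ *-assoc a b y ⟨
    a * b * y    ≈⟨ *-congʳ ab≈1 ⟩
    1# * y       ≈⟨ *-identityˡ y ⟩
    y            ∎

  -- Translation by 1 permutes the field, so the sum of all elements is unchanged when n copies of 1
  -- are added to it.
  cardinality×1≈0 : n × 1# ≈ 0#
  cardinality×1≈0 = +-identityʳ-unique (∑ id) (n × 1#) (sym (begin
    ∑ id                   ≈⟨ ∑-reindex id +-congʳ (translate-permutes 1#) ⟩
    ∑ (λ x → x + 1#)       ≈⟨ ∑-+ id (λ _ → 1#) ⟩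
    ∑ id + ∑ (λ _ → 1#)    ≈⟨ +-congˡ (∑-const 1#) ⟩
    ∑ id + n × 1#          ∎))

  infix 0 _⇒_∣_
  _⇒_∣_ : ∀ {p} {P : Set p} → Dec P → Carrier → Carrier → Carrier
  P? ⇒ u ∣ v = if Dec.does P? then u else v

  ⇒-true : ∀ {p} {P : Set p} (P? : Dec P) {u v} → P → (P? ⇒ u ∣ v) ≈ u
  ⇒-true P? p rewrite Dec.dec-true P? p = refl

  ⇒-false : ∀ {p} {P : Set p} (P? : Dec P) {u v} → ¬ P → (P? ⇒ u ∣ v) ≈ v
  ⇒-false P? ¬p rewrite Dec.dec-false P? ¬p = refl

  ⇒-cong : ∀ {p q} {P : Set p} {Q : Set q} (P? : Dec P) (Q? : Dec Q) {u v u′ v′} →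
    (P → Q) → (Q → P) → u ≈ u′ → v ≈ v′ → (P? ⇒ u ∣ v) ≈ (Q? ⇒ u′ ∣ v′)
  ⇒-cong (yes p) Q? f g u≈ v≈ = trans u≈ (sym (⇒-true Q? (f p)))
  ⇒-cong (no ¬p) Q? f g u≈ v≈ = trans v≈ (sym (⇒-false Q? (¬p ∘ g)))

  -- For nonzero a, `φ` replaces 0 by 1, so its product is that of all nonzero elements, which
  -- scaling by a preserves. Hence `ψ`, with a factor a at each nonzero element, has product 1; the
  -- remaining factor a, at 0, is supplied by `ψ′`.
  x↑n≈x : ∀ a → a ↑ n ≈ a
  x↑n≈x a with a ≟ 0#
  -- The index of a witnesses n > 0; for n = 0 the power would be 1.
  ... | yes a≈0 = lemma (index a)
    where
    lemma : ∀ {k} → Fin k → a ↑ k ≈ a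
    lemma {suc k} _ = trans (*-congʳ a≈0) (trans (zeroˡ _) (sym a≈0))
  ... | no a≉0 = begin
    a ↑ n                          ≈⟨ ∏-const a ⟨
    ∏ (λ _ → a)                    ≈⟨ ∏-cong ψ*ψ′ ⟩
    ∏ (λ x → ψ x * ψ′ x)           ≈⟨ ∏-* ψ ψ′ ⟩
    ∏ ψ * ∏ ψ′                     ≈⟨ *-cong ∏ψ≈1 ∏ψ′≈a ⟩
    1# * a                         ≈⟨ *-identityˡ a ⟩
    a                              ∎
    where
    φ ψ ψ′ : Carrier → Carrier
    φ  x = x ≟ 0# ⇒ 1# ∣ x
    ψ  x = x ≟ 0# ⇒ 1# ∣ a
    ψ′ x = x ≟ 0# ⇒ a ∣ 1#

    ψ*ψ′ : ∀ x → a ≈ ψ x * ψ′ x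
    ψ*ψ′ x with x ≟ 0#
    ... | yes _ = sym (*-identityˡ a)
    ... | no _  = sym (*-identityʳ a)

    φ≉0 : ∀ x → ¬ φ x ≈ 0#
    φ≉0 x with x ≟ 0#
    ... | yes _   = 1≉0
    ... | no x≉0  = x≉0

    φ-cong : ∀ {x y} → x ≈ y → φ x ≈ φ y
    φ-cong {x} {y} x≈y = ⇒-cong (x ≟ 0#) (y ≟ 0#) (trans (sym x≈y)) (trans x≈y) refl x≈y

    φ-scale : ∀ x → φ (a * x) ≈ ψ x * φ x
    φ-scale x with x ≟ 0#
    ... | yes x≈0 = trans (⇒-true (a * x ≟ 0#) (trans (*-congˡ x≈0) (zeroʳ a))) (sym (*-identityˡ 1#))
    ... | no x≉0  = ⇒-false (a * x ≟ 0#) (x≉0 ∘ x*y≈0⇒y≈0 a≉0)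

    ∏ψ≈1 : ∏ ψ ≈ 1#
    ∏ψ≈1 = *-cancelˡ-≉0 (∏-≉0 φ≉0) (begin
      ∏ φ * ∏ ψ               ≈⟨ *-comm _ _ ⟩
      ∏ ψ * ∏ φ               ≈⟨ ∏-* ψ φ ⟨
      ∏ (λ x → ψ x * φ x)     ≈⟨ ∏-cong φ-scale ⟨
      ∏ (φ ∘ (a *_))          ≈⟨ ∏-reindex φ-cong *-congˡ (scale-permutes a≉0) ⟨
      ∏ φ                     ≈⟨ *-identityʳ _ ⟨
      ∏ φ * 1#                ∎)

    ∏ψ′≈a : ∏ ψ′ ≈ a
    ∏ψ′≈a = ∏-singleton 0# (⇒-true (_ ≟ 0#)) (⇒-false (_ ≟ 0#))

  -- Otherwise x (x ↑ (d + 1) - 1), monic of degree d + 2, would vanish on the whole field, which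
  -- has more than d + 2 elements.
  x↑suc[d]≉1 : ∀ d → 2 ℕ.+ d < n → ¬ (∀ x → ¬ x ≈ 0# → x ↑ suc d ≈ 1#)
  x↑suc[d]≉1 d d+2<n x↑≈1 = monic-roots 1≉0 x*y≈0⇒y≈0 monic
    -- The bound reads 3 + d ≤ n, so the first 3 + d enumerated elements exist and are one too many
    -- to be roots.
    (λ i → elem (inject≤ i d+2<n)) (inject≤-injective _ _ _ _ ∘ elem-injective) (λ i → vanishes _)
    where
    f : Carrier → Carrier
    f x = x * (x ↑ suc d - 1#)
    monic : Monic (2 ℕ.+ d) f
    monic = horner 0# (horner (- 1#) (monic-↑ d) (λ _ → refl)) (λ _ → sym (+-identityʳ _))
    vanishes : ∀ x → f x ≈ 0#
    vanishes x with x ≟ 0#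
    ... | yes x≈0 = trans (*-congʳ x≈0) (zeroˡ _)
    ... | no x≉0  = trans (*-congˡ (trans (+-congʳ (x↑≈1 x x≉0)) (-‿inverseʳ 1#))) (zeroʳ x)

-- The form in which the prime power hypothesis enters the study of the quadratic extension.
FrobeniusAdditive : ∀ {c ℓ} → CommutativeRing c ℓ → ℕ → Set (c Level.⊔ ℓ)
FrobeniusAdditive F q = ∀ x y → (x + y) ↑ q ≈ x ↑ q + y ↑ q
  where
  open CommutativeRing F
  open CSExp commutativeSemiring renaming (_^_ to _↑_)

-- The quadratic extension: conjugation, trace, norm and the subfield.

module QuadraticExtension {c ℓ} (F : CommutativeRing c ℓ) (Q : ℕ) (fin : IsFiniteField F (suc Q ^ 2))
  (frobenius-+ : FrobeniusAdditive F (suc Q)) where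

  open CommutativeRing F
  open CSExp commutativeSemiring renaming (_^_ to _↑_)
  open FiniteField F fin
  open IsField (IsFiniteField.isField fin)
  open RingProperties ring
  open CommutativeSemigroupProperties *-commutativeSemigroup using (x∙yz≈y∙xz)
  open SMult semiring using (_×_; ×-congˡ; ×-homo-1)
  open CharacteristicP commutativeSemiring using (∣⇒×≈0)
  open SetoidReasoning setoid

  private
    -- Taking `Q` as the parameter makes q - 1 available without truncated subtraction.
    q : ℕ
    q = suc Q

  InSubfield : Carrier → Set ℓ
  InSubfield x = x ↑ q ≈ x

  frobenius² : ∀ x → (x ↑ q) ↑ q ≈ x
  frobenius² x = begin
    (x ↑ q) ↑ q          ≈⟨ ^-assocʳ x q q ⟩
    x ↑ (q ℕ.* q)        ≈⟨ ^-congʳ x (≡.cong (q ℕ.*_) (≡.sym (ℕ.*-identityʳ q))) ⟩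
    x ↑ (q ^ 2)          ≈⟨ x↑n≈x x ⟩
    x                    ∎

  frobenius-↑ : ∀ x k → (x ↑ k) ↑ q ≈ (x ↑ q) ↑ k
  frobenius-↑ x k = trans (^-assocʳ x k q) (trans (^-congʳ x (ℕ.*-comm k q)) (sym (^-assocʳ x q k)))

  -- Raising to the power q exchanges the two summands, by `frobenius²`.
  trace-inSubfield : ∀ x → InSubfield (Tr F q x)
  trace-inSubfield x = trans (frobenius-+ x (x ↑ q)) (trans (+-congˡ (frobenius² x)) (+-comm _ _))

  norm-inSubfield : ∀ x → InSubfield (x * x ↑ q)
  norm-inSubfield x = trans (^-distrib-* x (x ↑ q) q) (trans (*-congˡ (frobenius² x)) (*-comm _ _))

  -- Weighted sums and power sums over the subfield.

  χ : Carrier → Carrier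
  χ x = x ↑ q ≟ x ⇒ 1# ∣ 0#

  χ-translate : ∀ {t} x → InSubfield t → χ (x + t) ≈ χ x
  χ-translate {t} x t∈ = ⇒-cong ((x + t) ↑ q ≟ x + t) (x ↑ q ≟ x)
    (λ eq → +-cancelʳ t _ _ (trans (sym x+t) eq))
    (λ eq → trans x+t (+-congʳ eq)) refl refl
    where
    x+t : (x + t) ↑ q ≈ x ↑ q + t
    x+t = trans (frobenius-+ x t) (+-congˡ t∈)

  χ-scale : ∀ {b} x → ¬ b ≈ 0# → InSubfield b → χ (b * x) ≈ χ x
  χ-scale {b} x b≉0 b∈ = ⇒-cong ((b * x) ↑ q ≟ b * x) (x ↑ q ≟ x)
    (λ eq → *-cancelˡ-≉0 b≉0 (trans (sym bx) eq))
    (λ eq → trans bx (*-congˡ eq)) refl refl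
    where
    bx : (b * x) ↑ q ≈ b * x ↑ q
    bx = trans (^-distrib-* b x q) (*-congʳ b∈)

  χ-cong : ∀ {x y} → x ≈ y → χ x ≈ χ y
  χ-cong {x} {y} x≈y = ⇒-cong (x ↑ q ≟ x) (y ↑ q ≟ y)
    (λ eq → trans (^-congˡ q (sym x≈y)) (trans eq x≈y))
    (λ eq → trans (^-congˡ q x≈y) (trans eq (sym x≈y))) refl refl

  χ-*-cong : ∀ {x u v} → (InSubfield x → u ≈ v) → χ x * u ≈ χ x * v
  χ-*-cong {x} u≈v with x ↑ q ≟ x
  ... | yes x∈ = *-congˡ (u≈v x∈)
  ... | no _   = trans (zeroˡ _) (sym (zeroˡ _))

  ∑χ : (Carrier → Carrier) → Carrier
  ∑χ g = ∑ (λ x → χ x * g x)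

  ∑χ-cong : ∀ {g h} → (∀ x → InSubfield x → g x ≈ h x) → ∑χ g ≈ ∑χ h
  ∑χ-cong g≈h = ∑-cong (λ x → χ-*-cong (g≈h x))

  ∑χ-+ : ∀ g h → ∑χ (λ x → g x + h x) ≈ ∑χ g + ∑χ h
  ∑χ-+ g h = trans (∑-cong (λ x → distribˡ (χ x) (g x) (h x))) (∑-+ _ _)

  ∑χ-*ˡ : ∀ a g → ∑χ (λ x → a * g x) ≈ a * ∑χ g
  ∑χ-*ˡ a g = trans (∑-cong (λ x → x∙yz≈y∙xz (χ x) a (g x))) (∑-*ˡ a _)

  ∑χ-reindex : ∀ {g π} → (∀ {x y} → x ≈ y → g x ≈ g y) → (∀ {x y} → x ≈ y → π x ≈ π y) →
    IsPermutation F π → (∀ x → χ (π x) ≈ χ x) → ∑χ g ≈ ∑χ (g ∘ π)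
  ∑χ-reindex g-cong π-cong π-perm χπ≈χ = trans
    (∑-reindex (λ x≈y → *-cong (χ-cong x≈y) (g-cong x≈y)) π-cong π-perm)
    (∑-cong (λ x → *-congʳ (χπ≈χ x)))

  -- Translation by 1 preserves `χ`, so `∑χ id` absorbs this sum; it is the size of the subfield
  -- read inside the field.
  powerSum-0 : ∑χ (_↑ 0) ≈ 0#
  powerSum-0 = +-identityʳ-unique (∑χ id) _ (sym (begin
    ∑χ id                          ≈⟨ ∑χ-reindex id +-congʳ (translate-permutes 1#) (λ x → χ-translate x (1↑ q)) ⟩
    ∑χ (λ x → x + 1#)              ≈⟨ ∑χ-+ id (λ _ → 1#) ⟩
    ∑χ id + ∑χ (λ _ → 1#)          ∎))

  -- On the subfield x ↑ (q - 1) is 1 except at 0, where it is 0; adding the indicator `δ` of 0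
  -- turns it into the constant 1, whose sum vanishes.
  powerSum-Q : 0 < Q → ∑χ (_↑ Q) + 1# ≈ 0#
  powerSum-Q 0<Q = begin
    ∑χ (_↑ Q) + 1#                          ≈⟨ +-congˡ ∑δ≈1 ⟨
    ∑χ (_↑ Q) + ∑ δ                         ≈⟨ ∑-+ _ _ ⟨
    ∑ (λ x → χ x * x ↑ Q + δ x)             ≈⟨ ∑-cong pointwise ⟩
    ∑χ (_↑ 0)                               ≈⟨ powerSum-0 ⟩
    0#                                      ∎
    where
    δ : Carrier → Carrier
    δ x = x ≟ 0# ⇒ 1# ∣ 0#

    ∑δ≈1 : ∑ δ ≈ 1#
    ∑δ≈1 = ∑-singleton 0# (⇒-true (_ ≟ 0#)) (⇒-false (_ ≟ 0#))

    pointwise : ∀ x → χ x * x ↑ Q + δ x ≈ χ x * 1#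
    pointwise x with x ≟ 0#
    ... | yes x≈0 = begin
      χ x * x ↑ Q + 1#   ≈⟨ +-congʳ (trans (*-congˡ (trans (^-congˡ Q x≈0) (0↑ 0<Q))) (zeroʳ _)) ⟩
      0# + 1#            ≈⟨ +-identityˡ 1# ⟩
      1#                 ≈⟨ ⇒-true (x ↑ q ≟ x) (trans (*-congʳ x≈0) (trans (zeroˡ _) (sym x≈0))) ⟨
      χ x                ≈⟨ *-identityʳ _ ⟨
      χ x * 1#           ∎
    ... | no x≉0 = trans (+-identityʳ _)
      (χ-*-cong (λ x∈ → *-cancelˡ-≉0 x≉0 (trans x∈ (sym (*-identityʳ x)))))

  -- Scaling by a nonzero subfield element b multiplies the sum by b ↑ j. Were the sum nonzero,
  -- every nonzero norm would have j-th power 1, so x ↑ ((q + 1) j) = 1 for all nonzero x: too many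
  -- roots.
  powerSum-vanishes : ∀ j → 0 < j → j < Q → ∑χ (_↑ j) ≈ 0#
  powerSum-vanishes (suc j) _ j<Q with ∑χ (_↑ suc j) ≟ 0#
  ... | yes S≈0 = S≈0
  ... | no S≉0  = contradiction norm↑≈1 (x↑suc[d]≉1 _ bound)
    where
    scaled : ∀ b → ¬ b ≈ 0# → InSubfield b → b ↑ suc j ≈ 1#
    scaled b b≉0 b∈ = *-cancelˡ-≉0 S≉0 (begin
      ∑χ (_↑ suc j) * b ↑ suc j           ≈⟨ *-comm _ _ ⟩
      b ↑ suc j * ∑χ (_↑ suc j)           ≈⟨ ∑χ-*ˡ _ _ ⟨
      ∑χ (λ x → b ↑ suc j * x ↑ suc j)    ≈⟨ ∑χ-cong (λ x _ → ^-distrib-* b x (suc j)) ⟨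
      ∑χ (λ x → (b * x) ↑ suc j)          ≈⟨ ∑χ-reindex (^-congˡ (suc j)) *-congˡ (scale-permutes b≉0) (λ x → χ-scale x b≉0 b∈) ⟨
      ∑χ (_↑ suc j)                       ≈⟨ *-identityʳ _ ⟨
      ∑χ (_↑ suc j) * 1#                  ∎)

    norm↑≈1 : ∀ x → ¬ x ≈ 0# → x ↑ (suc q ℕ.* suc j) ≈ 1#
    norm↑≈1 x x≉0 = trans (sym (^-assocʳ x (suc q) (suc j)))
      (scaled (x ↑ suc q) (↑-≉0 (suc q) x≉0) (norm-inSubfield x))

    bound : suc (suc q ℕ.* suc j) < q ^ 2
    bound with ℕ.m≤n⇒∃[o]m+o≡n j<Q
    -- Now q = 3 + j + r, and the slack in the inequality becomes an explicit polynomial in j and r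
    -- with natural coefficients.
    ... | r , ≡.refl = ≡.subst (2 ℕ.+ suc q ℕ.* suc j ≤_) (expand j r) (ℕ.m≤m+n _ _)
      where
      expand : ∀ j r → 2 ℕ.+ (4 ℕ.+ j ℕ.+ r) ℕ.* (1 ℕ.+ j) ℕ.+ (3 ℕ.+ j ℕ.+ r ℕ.+ (4 ℕ.+ j ℕ.+ r) ℕ.* r)
        ≡ (3 ℕ.+ j ℕ.+ r) ℕ.* ((3 ℕ.+ j ℕ.+ r) ℕ.* 1)
      expand = solve-∀

  -- Power sums of x + c x⁴ and Hermite's criterion.

  module Quartic (c : Carrier) where

    -- The factor x ↑ a makes the expansion of (x + c x⁴) ↑ k a recursion on k.
    quarticSum : ℕ → ℕ → Carrier
    quarticSum a k = ∑χ (λ x → x ↑ a * (x + c * x ↑ 4) ↑ k)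

    quarticSum-0 : ∀ a → quarticSum a 0 ≈ ∑χ (_↑ a)
    quarticSum-0 a = ∑χ-cong (λ x _ → *-identityʳ (x ↑ a))

    quarticSum-suc : ∀ a k → quarticSum a (suc k) ≈ quarticSum (1 ℕ.+ a) k + c * quarticSum (4 ℕ.+ a) k
    quarticSum-suc a k = begin
      quarticSum a (suc k)                                                   ≈⟨ ∑χ-cong (λ x _ → expand x (x ↑ a) _) ⟩
      ∑χ (λ x → x ↑ (1 ℕ.+ a) * (x + c * x ↑ 4) ↑ k + c * (x ↑ 4 * x ↑ a * (x + c * x ↑ 4) ↑ k))
        ≈⟨ ∑χ-cong (λ x _ → +-congˡ (*-congˡ (*-congʳ (^-homo-* x 4 a)))) ⟨
      ∑χ (λ x → x ↑ (1 ℕ.+ a) * (x + c * x ↑ 4) ↑ k + c * (x ↑ (4 ℕ.+ a) * (x + c * x ↑ 4) ↑ k))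
        ≈⟨ ∑χ-+ _ _ ⟩
      quarticSum (1 ℕ.+ a) k + ∑χ (λ x → c * (x ↑ (4 ℕ.+ a) * (x + c * x ↑ 4) ↑ k))
        ≈⟨ +-congˡ (∑χ-*ˡ c _) ⟩
      quarticSum (1 ℕ.+ a) k + c * quarticSum (4 ℕ.+ a) k                    ∎
      where
      open import Algebra.Solver.Ring.NaturalCoefficients.Default commutativeSemiring
      expand : ∀ x y z → y * ((x + c * x ↑ 4) * z) ≈ x * y * z + c * (x ↑ 4 * y * z)
      expand x y z = solve 5 (λ c x x⁴ y z → y :* ((x :+ c :* x⁴) :* z) := x :* y :* z :+ c :* (x⁴ :* y :* z))
        refl c x (x ↑ 4) y z

    -- The exponents occurring in the expansion run from a + k to a + 4 k, hence lie strictly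
    -- between 0 and q - 1, where power sums vanish.
    quarticSum-vanishes : ∀ k a → 0 < a ℕ.+ k → 4 ℕ.* k ℕ.+ a < Q → quarticSum a k ≈ 0#
    quarticSum-vanishes zero a 0<a a<Q =
      trans (quarticSum-0 a) (powerSum-vanishes a (≡.subst (0 <_) (ℕ.+-identityʳ a) 0<a) a<Q)
    quarticSum-vanishes (suc k) a _ <Q = begin
      quarticSum a (suc k)                                  ≈⟨ quarticSum-suc a k ⟩
      quarticSum (1 ℕ.+ a) k + c * quarticSum (4 ℕ.+ a) k
        ≈⟨ +-cong (quarticSum-vanishes k (1 ℕ.+ a) z<s (ℕ.≤-<-trans (ℕ.+-monoʳ-≤ (4 ℕ.* k) (ℕ.+-monoˡ-≤ a (s≤s z≤n))) <Q′))
                  (*-congˡ (quarticSum-vanishes k (4 ℕ.+ a) z<s <Q′)) ⟩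
      0# + c * 0#                                           ≈⟨ trans (+-identityˡ _) (zeroʳ c) ⟩
      0#                                                    ∎
      where
      <Q′ : 4 ℕ.* k ℕ.+ (4 ℕ.+ a) < Q
      <Q′ = ≡.subst (_< Q) (4[1+k]+a k a) <Q

    -- Only the leading monomial reaches the exponent q - 1; it has coefficient c ↑ k, and its power
    -- sum is -1.
    quarticSum-top : ∀ k a → 0 < Q → 4 ℕ.* k ℕ.+ a ≡ Q → quarticSum a k + c ↑ k ≈ 0#
    quarticSum-top zero a 0<Q ≡.refl = trans (+-congʳ (quarticSum-0 a)) (powerSum-Q 0<Q)
    quarticSum-top (suc k) a 0<Q eq = begin
      quarticSum a (suc k) + c ↑ suc k                      ≈⟨ +-congʳ (quarticSum-suc a k) ⟩
      quarticSum (1 ℕ.+ a) k + c * quarticSum (4 ℕ.+ a) k + c * c ↑ k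
        -- Choosing x instead of c x⁴ loses three degrees, so this branch stays below q - 1.
        ≈⟨ +-congʳ (+-congʳ (quarticSum-vanishes k (1 ℕ.+ a) z<s
             (ℕ.≤-trans (ℕ.≤-reflexive (≡.sym (ℕ.+-suc (4 ℕ.* k) (1 ℕ.+ a)))) (≡.subst (_ ≤_) eq′
               (ℕ.+-monoʳ-≤ (4 ℕ.* k) (ℕ.+-monoˡ-≤ a (s≤s (s≤s z≤n)))))))) ⟩
      0# + c * quarticSum (4 ℕ.+ a) k + c * c ↑ k           ≈⟨ +-congʳ (+-identityˡ _) ⟩
      c * quarticSum (4 ℕ.+ a) k + c * c ↑ k                ≈⟨ distribˡ c _ _ ⟨
      c * (quarticSum (4 ℕ.+ a) k + c ↑ k)                  ≈⟨ *-congˡ (quarticSum-top k (4 ℕ.+ a) 0<Q eq′) ⟩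
      c * 0#                                                ≈⟨ zeroʳ c ⟩
      0#                                                    ∎
      where
      eq′ : 4 ℕ.* k ℕ.+ (4 ℕ.+ a) ≡ Q
      eq′ = ≡.trans (≡.sym (4[1+k]+a k a)) eq

    -- Hermite's criterion with exponent m = Q / 4: as π permutes the subfield, the sum of π(x) ↑ m over
    -- it is the power sum of exponent m, which vanishes, whereas expanding it gives - c ↑ m.
    permutes-subfield⇒c≈0 : ∀ {m π} → 0 < m → Q ≡ 4 ℕ.* m → (∀ {x y} → x ≈ y → π x ≈ π y) →
      IsPermutation F π → (∀ x → χ (π x) ≈ χ x) → (∀ x → InSubfield x → π x ≈ x + c * x ↑ 4) → c ≈ 0#
    permutes-subfield⇒c≈0 {m} {π} 0<m Q≡4m π-cong π-perm χπ≈χ π≈ = x↑k≈0⇒x≈0 m (begin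
      c ↑ m                        ≈⟨ +-identityˡ _ ⟨
      0# + c ↑ m                   ≈⟨ +-congʳ (powerSum-vanishes m 0<m m<Q) ⟨
      ∑χ (_↑ m) + c ↑ m            ≈⟨ +-congʳ (∑χ-reindex (^-congˡ m) π-cong π-perm χπ≈χ) ⟩
      ∑χ (λ x → π x ↑ m) + c ↑ m   ≈⟨ +-congʳ (∑χ-cong (λ x x∈ → trans (^-congˡ m (π≈ x x∈)) (sym (*-identityˡ _)))) ⟩
      quarticSum 0 m + c ↑ m       ≈⟨ quarticSum-top m 0 (ℕ.<-trans 0<m m<Q) (≡.trans (ℕ.+-identityʳ _) (≡.sym Q≡4m)) ⟩
      0#                           ∎)
      where
      m<Q : m < Q
      m<Q = ≡.subst (m <_) (≡.sym Q≡4m) (ℕ.m<m+n m (ℕ.<-≤-trans 0<m (ℕ.m≤m+n m _)))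

  trace-scale : ∀ a {s} → InSubfield s → Tr F q (a * s) ≈ Tr F q a * s
  trace-scale a {s} s∈ = trans
    (+-congˡ (trans (^-distrib-* a s q) (*-congˡ s∈)))
    (sym (distribʳ s a (a ↑ q)))

  poly-cong : ∀ γ {x y} → x ≈ y → poly F q γ x ≈ poly F q γ y
  poly-cong γ x≈y = +-cong x≈y (*-congˡ (+-cong t (^-congˡ q t)))
    where t = ^-congˡ (q ℕ.+ 3) x≈y

  -- The case q = 1 + 4 m: nonvanishing of the trace and the conclusion that γ is zero.

  module _ {m} (Q≡4m : Q ≡ 4 ℕ.* m) where

    private
      Q[2+Q] : suc (Q ℕ.* (2 ℕ.+ Q)) ≡ q ^ 2
      Q[2+Q] = lemma Q
        where
        lemma : ∀ Q → suc (Q ℕ.* (2 ℕ.+ Q)) ≡ (1 ℕ.+ Q) ℕ.* ((1 ℕ.+ Q) ℕ.* 1)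
        lemma = solve-∀

      -- For m = 0 the field would have a single element, forcing 1 = 0.
      1≤m : 0 < m
      1≤m = ℕ.n≢0⇒n>0 λ { ≡.refl → 1≉0 (begin
        1#            ≈⟨ ×-homo-1 1# ⟨
        1 × 1#        ≈⟨ ×-congˡ (≡.cong (λ k → suc (k ℕ.* (2 ℕ.+ k))) Q≡4m) ⟨
        suc (Q ℕ.* (2 ℕ.+ Q)) × 1# ≈⟨ ×-congˡ Q[2+Q] ⟩
        (q ^ 2) × 1#  ≈⟨ cardinality×1≈0 ⟩
        0#            ∎) }

    -- q² is 1 plus an even number, so in characteristic 2 the vanishing multiple q² × 1 would equal
    -- 1.
    1+1≉0 : ¬ 1# + 1# ≈ 0#
    1+1≉0 1+1≈0 = 1≉0 (begin
      1#                                 ≈⟨ +-identityʳ 1# ⟨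
      1# + 0#                            ≈⟨ +-congˡ (∣⇒×≈0 (trans (+-congˡ (+-identityʳ 1#)) 1+1≈0) 2∣ 1#) ⟨
      suc (Q ℕ.* (2 ℕ.+ Q)) × 1#         ≈⟨ ×-congˡ Q[2+Q] ⟩
      (q ^ 2) × 1#                       ≈⟨ cardinality×1≈0 ⟩
      0#                                 ∎)
      where
      2∣ : 2 ∣ Q ℕ.* (2 ℕ.+ Q)
      2∣ = ∣.∣m⇒∣m*n (2 ℕ.+ Q) (≡.subst (2 ∣_) (≡.sym Q≡4m) (∣.∣m⇒∣m*n m (divides 2 ≡.refl)))

    -- Were the trace zero, u = γ ↑ ((q + 3) (q - 1)) would be -1, hence u ↑ (1 + 2m) = -1;
    -- but (q + 3) (q - 1) (1 + 2m) is a multiple of q² - 1.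
    trace-≉0 : ∀ {γ} → ¬ γ ≈ 0# → ¬ Tr F q (γ ↑ (q ℕ.+ 3)) ≈ 0#
    trace-≉0 {γ} γ≉0 tr≈0 = 1+1≉0 (trans (+-congˡ (trans (sym u↑≈1) u↑≈u)) 1+u≈0)
      where
      w u : Carrier
      w = γ ↑ (q ℕ.+ 3)
      u = w ↑ Q

      1+u≈0 : 1# + u ≈ 0#
      -- Since `w * u` unfolds to w ↑ q, the trace of w is w (1 + u), and w is nonzero.
      1+u≈0 = x*y≈0⇒y≈0 (↑-≉0 (q ℕ.+ 3) γ≉0)
        (trans (distribˡ w 1# u) (trans (+-congʳ (*-identityʳ w)) tr≈0))

      u²≈1 : u ↑ 2 ≈ 1#
      u²≈1 = +-cancelˡ u _ _ (begin
        u + u * (u * 1#)     ≈⟨ +-cong (sym (*-identityʳ u)) (*-congˡ (*-identityʳ u)) ⟩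
        u * 1# + u * u       ≈⟨ distribˡ u 1# u ⟨
        u * (1# + u)         ≈⟨ trans (*-congˡ 1+u≈0) (zeroʳ u) ⟩
        0#                   ≈⟨ 1+u≈0 ⟨
        1# + u               ≈⟨ +-comm 1# u ⟩
        u + 1#               ∎)

      u↑≈u : u ↑ (1 ℕ.+ 2 ℕ.* m) ≈ u
      u↑≈u = trans (*-congˡ (trans (sym (^-assocʳ u 2 m)) (trans (^-congˡ m u²≈1) (1↑ m)))) (*-identityʳ u)

      γ↑≈1 : γ ↑ (Q ℕ.* (2 ℕ.+ Q)) ≈ 1#
      γ↑≈1 = *-cancelˡ-≉0 γ≉0 (begin
        γ ↑ suc (Q ℕ.* (2 ℕ.+ Q))  ≈⟨ ^-congʳ γ Q[2+Q] ⟩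
        γ ↑ (q ^ 2)                ≈⟨ x↑n≈x γ ⟩
        γ                          ≈⟨ *-identityʳ γ ⟨
        γ * 1#                     ∎)

      -- With q = 1 + 4 m both sides equal 16 m (m + 1) (2 m + 1); the cofactor of q² - 1 is 2 (m +
      -- 1).
      exponents : (q ℕ.+ 3) ℕ.* (Q ℕ.* (1 ℕ.+ 2 ℕ.* m)) ≡ Q ℕ.* (2 ℕ.+ Q) ℕ.* (2 ℕ.* suc m)
      exponents rewrite Q≡4m = lemma m
        where
        lemma : ∀ m → (1 ℕ.+ 4 ℕ.* m ℕ.+ 3) ℕ.* (4 ℕ.* m ℕ.* (1 ℕ.+ 2 ℕ.* m))
          ≡ 4 ℕ.* m ℕ.* (2 ℕ.+ 4 ℕ.* m) ℕ.* (2 ℕ.* (1 ℕ.+ m))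
        lemma = solve-∀

      u↑≈1 : u ↑ (1 ℕ.+ 2 ℕ.* m) ≈ 1#
      u↑≈1 = begin
        u ↑ (1 ℕ.+ 2 ℕ.* m)                             ≈⟨ ^-assocʳ w Q (1 ℕ.+ 2 ℕ.* m) ⟩
        w ↑ (Q ℕ.* (1 ℕ.+ 2 ℕ.* m))                     ≈⟨ ^-assocʳ γ (q ℕ.+ 3) (Q ℕ.* (1 ℕ.+ 2 ℕ.* m)) ⟩
        γ ↑ ((q ℕ.+ 3) ℕ.* (Q ℕ.* (1 ℕ.+ 2 ℕ.* m)))     ≈⟨ ^-congʳ γ exponents ⟩
        γ ↑ (Q ℕ.* (2 ℕ.+ Q) ℕ.* (2 ℕ.* suc m))         ≈⟨ ^-assocʳ γ (Q ℕ.* (2 ℕ.+ Q)) (2 ℕ.* suc m) ⟨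
        (γ ↑ (Q ℕ.* (2 ℕ.+ Q))) ↑ (2 ℕ.* suc m)         ≈⟨ ^-congˡ (2 ℕ.* suc m) γ↑≈1 ⟩
        1# ↑ (2 ℕ.* suc m)                              ≈⟨ 1↑ (2 ℕ.* suc m) ⟩
        1#                                              ∎

    permutes⇒γ≈0 : ∀ γ → IsPermutation F (poly F q γ) → γ ≈ 0#
    permutes⇒γ≈0 γ perm with γ ≟ 0#
    ... | yes γ≈0 = γ≈0
    ... | no γ≉0 with inverse γ γ≉0
    ...   | γ⁻¹ , γγ⁻¹≈1 = contradiction
      (permutes-subfield⇒c≈0 1≤m Q≡4m (*-congˡ ∘ poly-cong γ ∘ *-congˡ) π-perm
        -- `π` moves each x by a trace, which lies in the subfield, so membership in the subfield is
        -- unaffected.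
        (λ x → trans (χ-cong (π≈ x)) (χ-translate x (trace-inSubfield _)))
        (λ x x∈ → trans (π≈ x) (+-congˡ (on-subfield x x∈))))
      (trace-≉0 γ≉0)
      where
      open Quartic (Tr F q (γ ↑ (q ℕ.+ 3)))

      γ⁻¹≉0 : ¬ γ⁻¹ ≈ 0#
      γ⁻¹≉0 eq = 1≉0 (trans (sym γγ⁻¹≈1) (trans (*-congˡ eq) (zeroʳ γ)))

      γ⁻¹γ : ∀ x → γ⁻¹ * (γ * x) ≈ x
      γ⁻¹γ x = trans (sym (*-assoc γ⁻¹ γ x))
        (trans (*-congʳ (trans (*-comm γ⁻¹ γ) γγ⁻¹≈1)) (*-identityˡ x))

      π : Carrier → Carrier
      π x = γ⁻¹ * poly F q γ (γ * x)

      π-perm : IsPermutation F π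
      π-perm = Composition.bijective _≈_ _≈_ _≈_ (scale-permutes γ≉0)
        (Composition.bijective _≈_ _≈_ _≈_ perm (scale-permutes γ⁻¹≉0))

      π≈ : ∀ x → π x ≈ x + Tr F q ((γ * x) ↑ (q ℕ.+ 3))
      π≈ x = trans (distribˡ γ⁻¹ _ _) (+-cong (γ⁻¹γ x) (γ⁻¹γ _))

      -- For x in the subfield, x ↑ (q + 3) collapses to x ↑ 4, a subfield element that the trace
      -- lets through.
      on-subfield : ∀ x → InSubfield x → Tr F q ((γ * x) ↑ (q ℕ.+ 3)) ≈ Tr F q (γ ↑ (q ℕ.+ 3)) * x ↑ 4
      on-subfield x x∈ = begin
        Tr F q ((γ * x) ↑ (q ℕ.+ 3))                ≈⟨ +-cong eq (^-congˡ q eq) ⟩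
        Tr F q (γ ↑ (q ℕ.+ 3) * x ↑ 4)              ≈⟨ trace-scale _ (trans (frobenius-↑ x 4) (^-congˡ 4 x∈)) ⟩
        Tr F q (γ ↑ (q ℕ.+ 3)) * x ↑ 4              ∎
        where
        eq : (γ * x) ↑ (q ℕ.+ 3) ≈ γ ↑ (q ℕ.+ 3) * x ↑ 4
        eq = trans (^-distrib-* γ x (q ℕ.+ 3))
          (*-congˡ (trans (^-homo-* x q 3) (*-congʳ x∈)))

-- The converse direction, and the characteristic of the field.

module _ {c ℓ} (F : CommutativeRing c ℓ) where
  open CommutativeRing F
  open CSExp commutativeSemiring renaming (_^_ to _↑_)
  open SMult semiring using (_×_; ×1-homo-*; ×-homo-1; ×-congˡ)

  γ≈0⇒permutes : ∀ q {γ} → γ ≈ 0# → IsPermutation F (poly F q γ)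
  γ≈0⇒permutes q {γ} γ≈0 =
    (λ {x} {y} eq → trans (sym (poly≈id x)) (trans eq (poly≈id y))) ,
    (λ y → y , λ {z} z≈y → trans (poly≈id z) z≈y)
    where
    poly≈id : ∀ x → poly F q γ x ≈ x
    poly≈id x = trans (+-congˡ (trans (*-congʳ γ≈0) (zeroˡ _))) (+-identityʳ x)

  ×1-homo-^ : ∀ p k → (p ^ k) × 1# ≈ (p × 1#) ↑ k
  ×1-homo-^ p zero    = ×-homo-1 1#
  ×1-homo-^ p (suc k) = trans (×1-homo-* p (p ^ k)) (*-congˡ (×1-homo-^ p k))

  -- With q = p ↑ k, the power (p × 1) ↑ (2 k) is q² × 1 = 0; a field has no nilpotents, so p × 1 =
  -- 0 and the p-power map is additive.
  primePower⇒frobenius-+ : ∀ {q} → PrimePower q → IsFiniteField F (q ^ 2) → FrobeniusAdditive F q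
  primePower⇒frobenius-+ (p , k , pr , _ , ≡.refl) fin =
    CharacteristicP.^pᵏ-homo-+ commutativeSemiring pr (x↑k≈0⇒x≈0 (k ℕ.* 2) p↑≈0) k
    where
    open FiniteField F fin
    p↑≈0 : (p × 1#) ↑ (k ℕ.* 2) ≈ 0#
    p↑≈0 = trans (sym (×1-homo-^ p (k ℕ.* 2)))
      (trans (×-congˡ (≡.sym (ℕ.^-*-assoc p k 2))) cardinality×1≈0)

theorem3p4 : ∀ {c ℓ : Level} (q : ℕ) → PrimePower q → 2 ∤ q → q % 4 ≡ 1 →
    (F : CommutativeRing c ℓ) → IsFiniteField F (q ^ 2) →
    let open CommutativeRing F in
    (γ : Carrier) → IsPermutation F (poly F q γ) ⇔ γ ≈ 0#
theorem3p4 zero _ _ ()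
theorem3p4 (suc Q) pp _ q%4≡1 F fin γ = mk⇔
  -- As q leaves remainder 1 modulo 4, the floor of q / 4 is (q - 1) / 4.
  (permutes⇒γ≈0 {m = suc Q ℕ./ 4} Q≡4m γ)
  (γ≈0⇒permutes F (suc Q))
  where
  open QuadraticExtension F Q fin (primePower⇒frobenius-+ F pp fin)

  Q≡4m : Q ≡ 4 ℕ.* (suc Q ℕ./ 4)
  Q≡4m = ℕ.suc-injective (≡.trans (ℕ.m≡m%n+[m/n]*n (suc Q) 4)
    (≡.cong₂ ℕ._+_ q%4≡1 (ℕ.*-comm (suc Q ℕ./ 4) 4)))
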